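{- The sets of patterns $\{112,2122\}$ and $\{121,1222\}$ are $m$-equivalent, that is, $\{112,2122\}\sim\{121,1222\}$.
   Context: A (finite, reduced) multiset is $S=1^{a_1}2^{a_2}\cdots k^{a_k}$ with $k\ge 1$ and all $a_i\ge 1$, meaning that $i$ occurs with multiplicity $a_i$. A multipermutation of $S$ is a word having exactly $a_i$ occurrences of each letter $i\in[k]=\{1,\dots,k\}$ and no other letters. A word $\pi=\pi_1\cdots\pi_n$ contains a pattern (word) $\rho=\rho_1\cdots\rho_\ell$ if there are indices $i(1)<\cdots<i(\ell)$ such that for all $a,b\in[\ell]$: $\pi_{i(a)}<\pi_{i(b)}$ iff $\rho_a<\rho_b$, and $\pi_{i(a)}>\pi_{i(b)}$ iff $\rho_a>\rho_b$; otherwise $\pi$ avoids $\rho$. For a set $P$ of patterns, $\mathrm{av}(S;P)$ is the number of multipermutations of $S$ that avoid every pattern in $P$. Two sets of patterns $P,Q$ are $m$-equivalent, written here $P\sim Q$, if $\mathrm{av}(S;P)=\mathrm{av}(S;Q)$ for every multiset $S$. -}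

module Defs where

open import Data.Nat using (ℕ; zero; suc; _+_; _≤_; _<_; _≤?_; _<?_; _≟_; _≡ᵇ_; s≤s)
open import Data.Nat.Properties using (+-0-commutativeMonoid; suc-injective)
open import Algebra.Properties.CommutativeMonoid.Sum +-0-commutativeMonoid
  using (sum; sum-cong-≗; ∑-distrib-+; sum-replicate-zero)
open import Data.Fin as Fin using (Fin; zero; suc; toℕ; finToFun; funToFin)
import Data.Fin.Properties as Fin
open import Data.List using (List; []; _∷_; length; lookup; map; filter; upTo; cartesianProductWith)
open import Data.List.Properties using (∷-injective)
open import Data.List.Membership.Propositional using (_∈_)
open import Data.List.Membership.Propositional.Properties
  using (∈-map⁺; ∈-upTo⁺; ∈-filter⁺; ∈-filter⁻; ∈-cartesianProductWith⁺)
open import Data.List.Relation.Unary.All as All using (All; []; _∷_)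
open import Data.List.Relation.Unary.Any using (here)
open import Data.List.Relation.Unary.AllPairs using ([]; _∷_)
open import Data.List.Relation.Unary.Unique.Propositional using (Unique)
import Data.List.Relation.Unary.Unique.Propositional.Properties as Unique
open import Data.Product using (∃-syntax; _×_; _,_; proj₂)
open import Data.Bool using (true; false)
open import Function using (_⇔_; mk⇔; Equivalence)
open import Relation.Nullary using (¬_; Dec)
open import Relation.Nullary.Decidable using (map′; ¬?; _×-dec_; _→-dec_)
open import Relation.Unary using (Decidable)
open import Relation.Binary.PropositionalEquality
  using (_≡_; _≗_; refl; sym; trans; cong; cong₂; subst; subst₂)

Word : Set
Word = List ℕ

-- The multiset 1^{a_1} ⋯ k^{a_k}; since Fin k counts from 0, the letter
-- i + 1 has multiplicity mult i.
record Multiset : Set where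
  field
    k      : ℕ
    k≥1    : 1 ≤ k
    mult   : Fin k → ℕ
    mult≥1 : ∀ i → 1 ≤ mult i

  size : ℕ
  size = sum mult

open Multiset public

occurrences : ℕ → Word → ℕ
occurrences x π = length (filter (x ≟_) π)

IsMultipermutation : Multiset → Word → Set
IsMultipermutation S π =
  All (λ x → 1 ≤ x × x ≤ k S) π ×
  (∀ i → occurrences (suc (toℕ i)) π ≡ mult S i)

-- ι selects the subsequence of π that is order-isomorphic to ρ.
IsOccurrence : (π ρ : Word) → (Fin (length ρ) → Fin (length π)) → Set
IsOccurrence π ρ ι =
  (∀ a b → a Fin.< b → ι a Fin.< ι b) ×
  (∀ a b → (lookup π (ι a) < lookup π (ι b) ⇔ lookup ρ a < lookup ρ b) ×
           (lookup π (ι b) < lookup π (ι a) ⇔ lookup ρ b < lookup ρ a))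

Contains : Word → Word → Set
Contains π ρ = ∃[ ι ] IsOccurrence π ρ ι

Avoids : Word → Word → Set
Avoids π ρ = ¬ Contains π ρ

-- A finite set of patterns is given by a list; order and repetitions are
-- irrelevant to avoidance.
PatternSet : Set
PatternSet = List Word

AvoidsAll : PatternSet → Word → Set
AvoidsAll P π = All (Avoids π) P

isMultipermutation? : ∀ S → Decidable (IsMultipermutation S)
isMultipermutation? S π =
  All.all? (λ x → 1 ≤? x ×-dec x ≤? k S) π ×-dec
  Fin.all? (λ i → occurrences (suc (toℕ i)) π ≟ mult S i)

infix 3 _⇔-dec_

_⇔-dec_ : ∀ {A B : Set} → Dec A → Dec B → Dec (A ⇔ B)
a? ⇔-dec b? =
  map′ (λ (f , g) → mk⇔ f g) (λ e → Equivalence.to e , Equivalence.from e)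
       ((a? →-dec b?) ×-dec (b? →-dec a?))

isOccurrence? : ∀ π ρ → Decidable (IsOccurrence π ρ)
isOccurrence? π ρ ι =
  Fin.all? (λ a → Fin.all? λ b → (a Fin.<? b) →-dec (ι a Fin.<? ι b)) ×-dec
  Fin.all? (λ a → Fin.all? λ b →
    (lookup π (ι a) <? lookup π (ι b) ⇔-dec lookup ρ a <? lookup ρ b) ×-dec
    (lookup π (ι b) <? lookup π (ι a) ⇔-dec lookup ρ b <? lookup ρ a))

isOccurrence-resp-≗ : ∀ π ρ {ι κ} → ι ≗ κ → IsOccurrence π ρ ι → IsOccurrence π ρ κ
isOccurrence-resp-≗ π ρ eq (mono , iso) =
  (λ a b a<b → subst₂ Fin._<_ (eq a) (eq b) (mono a b a<b)) ,
  (λ a b → subst₂ (λ x y → (lookup π x < lookup π y ⇔ lookup ρ a < lookup ρ b) ×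
                           (lookup π y < lookup π x ⇔ lookup ρ b < lookup ρ a))
                  (eq a) (eq b) (iso a b))

contains? : ∀ π ρ → Dec (Contains π ρ)
contains? π ρ =
  map′ (λ (c , occ) → finToFun c , occ)
       (λ (ι , occ) → funToFin ι ,
          isOccurrence-resp-≗ π ρ (λ a → sym (Fin.finToFun-funToFin ι a)) occ)
       (Fin.any? (λ c → isOccurrence? π ρ (finToFun c)))

avoidsAll? : ∀ P → Decidable (AvoidsAll P)
avoidsAll? P π = All.all? (λ ρ → ¬? (contains? π ρ)) P

words : List ℕ → ℕ → List Word
words xs zero    = [] ∷ []
words xs (suc n) = cartesianProductWith _∷_ xs (words xs n)

multipermutations : Multiset → List Word
multipermutations S =
  filter (isMultipermutation? S) (words (map suc (upTo (k S))) (size S))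

av : Multiset → PatternSet → ℕ
av S P = length (filter (avoidsAll? P) (multipermutations S))

infix 4 _~_

_~_ : PatternSet → PatternSet → Set
P ~ Q = ∀ S → av S P ≡ av S Q

-- The facts below show that multipermutations S lists every
-- multipermutation of S exactly once, so that av is the intended count.

words-complete : ∀ {xs π} → All (_∈ xs) π → π ∈ words xs (length π)
words-complete []       = here refl
words-complete (p ∷ ps) = ∈-cartesianProductWith⁺ _∷_ p (words-complete ps)

words-unique : ∀ {xs} → Unique xs → ∀ n → Unique (words xs n)
words-unique u zero    = [] ∷ []
words-unique u (suc n) =
  Unique.cartesianProductWith⁺ _∷_ ∷-injective u (words-unique u n)

private
  δ : ℕ → ℕ → ℕ
  δ x y = occurrences x (y ∷ [])

  δ-suc : ∀ x y → δ (suc x) (suc y) ≡ δ x y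
  δ-suc x y with x ≡ᵇ y
  ... | true  = refl
  ... | false = refl

  occurrences-∷ : ∀ x y π → occurrences x (y ∷ π) ≡ δ x y + occurrences x π
  occurrences-∷ x y π with x ≡ᵇ y
  ... | true  = refl
  ... | false = refl

  sum-δ : ∀ k y → y < k → sum {k} (λ i → δ (toℕ i) y) ≡ 1
  sum-δ (suc k) zero    _         = cong suc (sum-replicate-zero k)
  sum-δ (suc k) (suc y) (s≤s y<k) =
    trans (sum-cong-≗ {k} (λ i → δ-suc (toℕ i) y)) (sum-δ k y y<k)

length≡sum-occurrences : ∀ k π → All (λ x → 1 ≤ x × x ≤ k) π →
  length π ≡ sum {k} (λ i → occurrences (suc (toℕ i)) π)
length≡sum-occurrences k [] [] = sym (sum-replicate-zero k)
length≡sum-occurrences k (suc y ∷ π) ((_ , y<k) ∷ ps) = sym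
  (trans (sum-cong-≗ {k} λ i → occurrences-∷ (suc (toℕ i)) (suc y) π)
  (trans (∑-distrib-+ {k} (λ i → δ (suc (toℕ i)) (suc y)) _)
  (cong₂ _+_
    (trans (sum-cong-≗ {k} λ i → δ-suc (toℕ i) y) (sum-δ k y y<k))
    (sym (length≡sum-occurrences k π ps)))))

∈-multipermutations : ∀ S π → π ∈ multipermutations S ⇔ IsMultipermutation S π
∈-multipermutations S π = mk⇔
  (λ π∈ → proj₂ (∈-filter⁻ (isMultipermutation? S) {xs = words (map suc (upTo (k S))) (size S)} π∈))
  (λ m@(inRange , occ) → ∈-filter⁺ (isMultipermutation? S)
    (subst (λ n → π ∈ words _ n)
      (trans (length≡sum-occurrences (k S) π inRange) (sum-cong-≗ {k S} occ))
      (words-complete (All.map (λ { {suc x} (_ , x<k) → ∈-map⁺ suc (∈-upTo⁺ x<k) }) inRange)))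
    m)

multipermutations-unique : ∀ S → Unique (multipermutations S)
multipermutations-unique S =
  Unique.filter⁺ (isMultipermutation? S)
    (words-unique (Unique.map⁺ suc-injective (Unique.upTo⁺ (k S))) (size S))

{-# OPTIONS --safe #-}

-- Add the letters from largest to smallest. A word avoiding 112 arises from its
-- restriction w to the letters above its minimum x by cutting w = u v into
-- u x v x⋯x; a word avoiding 121 arises as u x⋯x v. Avoidance of 2122
-- (resp. 1222) restricts the cuts: no letter of u may occur twice in v
-- (resp. no letter may occur three times in v). If w has m allowed cuts, then in
-- both cases the m new words have m + 1 allowed cuts each if x is added once,
-- m + 2 each if x is added twice, and 3, …, m + 2 if x is added more often.
-- Hence both classes have the same generating tree.
module Submission where

open import Defs
open import Data.Nat
open import Data.Nat.Properties
open import Data.Fin as Fin using (Fin; zero; suc; toℕ)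
open import Data.List hiding (_∷ʳ_; find)
open import Data.List.Properties
open import Data.List.Membership.Propositional using (_∈_; find; lose)
open import Data.List.Membership.Propositional.Properties
open import Data.List.Membership.Propositional.Properties.WithK using (unique∧set⇒bag)
open import Data.List.Relation.Unary.All as All using (All; []; _∷_)
import Data.List.Relation.Unary.All.Properties as All
open import Data.List.Relation.Unary.Any as Any using (Any; here; there)
open import Data.List.Relation.Unary.Any.Properties using (lookup-index)
open import Data.List.Relation.Unary.AllPairs as AllPairs using (AllPairs; []; _∷_)
import Data.List.Relation.Unary.AllPairs.Properties as AllPairs
open import Data.List.Relation.Unary.Unique.Propositional using (Unique)
import Data.List.Relation.Unary.Unique.Propositional.Properties as Unique
open import Data.List.Relation.Binary.Sublist.Propositional
  using (_⊆_; []; _∷_; _∷ʳ_; ⊆-refl; ⊆-trans; minimum; from∈; to∈)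
open import Data.List.Relation.Binary.Sublist.Propositional.Properties
  using (filter-⊆; filter⁺; ++⁺; ++⁺ˡ; ∷⁻; ∷ʳ⁻; ∷ˡ⁻; length-mono-≤; All-resp-⊆)
open import Data.List.Relation.Binary.Permutation.Propositional
  using (_↭_; ↭-refl; ↭-reflexive; ↭-trans)
import Data.List.Relation.Binary.Permutation.Propositional.Properties as ↭
open import Data.List.Relation.Binary.BagAndSetEquality using (∼bag⇒↭; ↭⇒∼bag; >>=-cong)
open import Data.Product using (∃-syntax; Σ-syntax; _×_; _,_; proj₁; proj₂; uncurry)
open import Data.Sum as Sum using (_⊎_; inj₁; inj₂)
open import Data.Empty using (⊥-elim)
open import Function using (_∘_; _⇔_; mk⇔; Equivalence)
open import Function.Related.Propositional using (K-refl)
open import Relation.Nullary using (¬_; Dec; yes; no)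
open import Relation.Nullary.Decidable using (¬?)
open import Relation.Unary using (Decidable)
open import Relation.Binary.PropositionalEquality

-- Words

-- No explicit bijection is built. A word is labelled by its number of allowed cuts, which is also
-- its number of children, and the two trees are compared through the multiset of labels on each
-- level. With at most two copies, x can never make a cut forbidden: all old cuts keep their status
-- and each copy brings one new cut. With three or more copies the two classes behave as mirror
-- images. For 112 and 2122, a cut to the right of the first x survives only in the last two
-- positions, while the allowed cuts up to the insertion point remain. For 121 and 1222, every cut
-- with three copies of x on its right dies, while the cuts inside v and the last two before v
-- remain. So the j-th allowed cut, counted from the left in the first class and from the right in
-- the second, gives the label j + 2. This is why labels are compared only up to order.

infix 4 _#_

_#_ : ℕ → Word → Set
x # w = All (x ≢_) w

≢? : ∀ x → Decidable (x ≢_)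
≢? x y = ¬? (x ≟ y)

remove : ℕ → Word → Word
remove x = filter (≢? x)

remove-# : ∀ {x w} → x # w → remove x w ≡ w
remove-# {x} = filter-all (≢? x)

#-remove : ∀ x w → x # remove x w
#-remove x w = All.all-filter (≢? x) w

remove-++ : ∀ x u v → remove x (u ++ v) ≡ remove x u ++ remove x v
remove-++ x = filter-++ (≢? x)

remove-∷≡ : ∀ x w → remove x (x ∷ w) ≡ remove x w
remove-∷≡ x w = filter-reject (≢? x) (λ x≢x → x≢x refl)

remove-∷≢ : ∀ {x y} w → x ≢ y → remove x (y ∷ w) ≡ y ∷ remove x w
remove-∷≢ {x} w x≢y = filter-accept (≢? x) x≢y

remove-first : ∀ {x} u t → x # u → remove x (u ++ x ∷ t) ≡ u ++ remove x t
remove-first {x} u t x#u = trans (remove-++ x u _) (cong₂ _++_ (remove-# x#u) (remove-∷≡ x t))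

remove-replicate : ∀ x n → remove x (replicate n x) ≡ []
remove-replicate x n = filter-none (≢? x) (All.replicate⁺ n λ x≢x → x≢x refl)

occ-∷≡ : ∀ x w → occurrences x (x ∷ w) ≡ suc (occurrences x w)
occ-∷≡ x w = cong length (filter-accept (x ≟_) refl)

occ-∷≢ : ∀ {x y} w → x ≢ y → occurrences x (y ∷ w) ≡ occurrences x w
occ-∷≢ {x} w x≢y = cong length (filter-reject (x ≟_) x≢y)

occ-++ : ∀ x u v → occurrences x (u ++ v) ≡ occurrences x u + occurrences x v
occ-++ x u v = trans (cong length (filter-++ (x ≟_) u v)) (length-++ (filter (x ≟_) u))

occ-# : ∀ {x w} → x # w → occurrences x w ≡ 0
occ-# {x} x#w = cong length (filter-none (x ≟_) x#w)

occ-replicate : ∀ x n → occurrences x (replicate n x) ≡ n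
occ-replicate x n = trans (cong length (filter-all (x ≟_) (All.replicate⁺ n refl))) (length-replicate n)

occ-remove : ∀ {x y} w → y ≢ x → occurrences y (remove x w) ≡ occurrences y w
occ-remove []      _   = refl
occ-remove {x} {y} (z ∷ w) y≢x with x ≟ z
... | yes refl = trans (cong (occurrences y) (remove-∷≡ x w))
                   (trans (occ-remove w y≢x) (sym (occ-∷≢ w y≢x)))
... | no x≢z with y ≟ z
...   | yes refl = trans (cong (occurrences y) (remove-∷≢ w x≢z))
                    (trans (occ-∷≡ y _) (trans (cong suc (occ-remove w y≢x)) (sym (occ-∷≡ y w))))
...   | no y≢z   = trans (cong (occurrences y) (remove-∷≢ w x≢z))
                    (trans (occ-∷≢ _ y≢z) (trans (occ-remove w y≢x) (sym (occ-∷≢ w y≢z))))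

occ≤length : ∀ x w → occurrences x w ≤ length w
occ≤length x = length-filter (x ≟_)

All-remove⁺ : ∀ {P : ℕ → Set} x w → All P w → All P (remove x w)
All-remove⁺ x w = All.filter⁺ (≢? x)

All-remove⁻ : ∀ {P : ℕ → Set} {x} w → P x → All P (remove x w) → All P w
All-remove⁻ []      px _  = []
All-remove⁻ {P} {x} (y ∷ w) px ps with x ≟ y
... | yes refl = px ∷ All-remove⁻ w px (subst (All P) (remove-∷≡ x w) ps)
... | no x≢y with subst (All P) (remove-∷≢ w x≢y) ps
...   | py ∷ ps′ = py ∷ All-remove⁻ w px ps′

skip-# : ∀ {x} {σ : Word} u {t} → x # u → x ∷ σ ⊆ u ++ t → x ∷ σ ⊆ t
skip-# []      _           s          = s
skip-# (y ∷ u) (_ ∷ x#u)   (_ ∷ʳ s)   = skip-# u x#u s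
skip-# (y ∷ u) (x≢y ∷ _)   (refl ∷ _) = ⊥-elim (x≢y refl)

first-letter : ∀ {x} {σ : Word} u {t : Word} → x ∷ σ ⊆ u ++ t → x ∈ u ⊎ x ∷ σ ⊆ t
first-letter []      s          = inj₂ s
first-letter (y ∷ u) (_ ∷ʳ s)   = Sum.map₁ there (first-letter u s)
first-letter (y ∷ u) (refl ∷ _) = inj₁ (here refl)

⊆-remove : ∀ {x σ w} → x # σ → σ ⊆ w → σ ⊆ remove x w
⊆-remove {x} x#σ s = subst (_⊆ _) (remove-# x#σ) (filter⁺ (≢? x) (≢? x) (λ { refl p → p }) s)

#-replicate : ∀ {x y} n → x ≢ y → x # replicate n y
#-replicate n = All.replicate⁺ n

replicate⊆⇒≤occ : ∀ n q v → replicate n q ⊆ v → n ≤ occurrences q v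
replicate⊆⇒≤occ n q v s = subst (_≤ _) (occ-replicate q n)
  (length-mono-≤ (filter⁺ (q ≟_) (q ≟_) (λ { refl p → p }) s))

≤occ⇒replicate⊆ : ∀ n q v → n ≤ occurrences q v → replicate n q ⊆ v
≤occ⇒replicate⊆ zero    q v       _ = minimum v
≤occ⇒replicate⊆ (suc n) q (y ∷ v) h with q ≟ y
... | yes refl = refl ∷ ≤occ⇒replicate⊆ n q v (≤-pred (subst (suc n ≤_) (occ-∷≡ q v) h))
... | no q≢y   = y ∷ʳ ≤occ⇒replicate⊆ (suc n) q v (subst (suc n ≤_) (occ-∷≢ v q≢y) h)

-- Pattern occurrences as sublists

-- Induction on `π`: if `ι` starts at the head, the head is matched, otherwise it is skipped. In
-- both cases strict monotonicity keeps the remaining indices off the head, so they can be lowered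
-- by one.
tabulate⊆ : ∀ {n} (π : Word) (ι : Fin n → Fin (length π)) →
  (∀ a b → a Fin.< b → ι a Fin.< ι b) → tabulate (lookup π ∘ ι) ⊆ π
tabulate⊆ {zero}  π ι mono = minimum π
tabulate⊆ {suc n} [] ι mono with () ← ι zero
tabulate⊆ {suc n} (x ∷ π) ι mono = go (ι zero) refl
  where
  below : ∀ {m n} {j : Fin (suc n)} (κ : Fin m → Fin (suc n)) → (∀ a → j Fin.< κ a) →
    ∃[ κ′ ] (∀ a → κ a ≡ suc (κ′ a))
  below κ pos = (λ a → proj₁ (lower a (pos a))) , λ a → proj₂ (lower a (pos a))
    where
    lower : ∀ a {i} → i Fin.< κ a → ∃[ b ] κ a ≡ suc b
    lower a i<κ with κ a
    ... | suc b = b , refl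

  shift : ∀ {m} (κ : Fin m → Fin (suc (length π))) (κ′ : Fin m → Fin (length π)) →
    (∀ a → κ a ≡ suc (κ′ a)) → (∀ a b → a Fin.< b → κ a Fin.< κ b) →
    tabulate (lookup (x ∷ π) ∘ κ) ⊆ π
  shift κ κ′ eq mono′ = subst (_⊆ π) (tabulate-cong λ a → cong (lookup (x ∷ π)) (sym (eq a)))
    (tabulate⊆ π κ′ λ a b a<b → ≤-pred (subst₂ Fin._<_ (eq a) (eq b) (mono′ a b a<b)))

  go : ∀ i → ι zero ≡ i → tabulate (lookup (x ∷ π) ∘ ι) ⊆ x ∷ π
  go zero eq =
    let κ′ , eq′ = below (ι ∘ suc) λ a → mono zero (suc a) (s≤s z≤n)
    in cong (lookup (x ∷ π)) eq ∷ shift (ι ∘ suc) κ′ eq′ λ a b a<b → mono (suc a) (suc b) (s≤s a<b)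
  go (suc i) eq =
    let κ′ , eq′ = below (ι ∘ suc) λ a → mono zero (suc a) (s≤s z≤n)
    in x ∷ʳ shift ι (λ { zero → i ; (suc a) → κ′ a }) (λ { zero → eq ; (suc a) → eq′ a }) mono

⊆tabulate : ∀ {n} {π : Word} (f : Fin n → ℕ) → tabulate f ⊆ π →
  Σ[ ι ∈ (Fin n → Fin (length π)) ] (∀ a b → a Fin.< b → ι a Fin.< ι b) × (∀ a → lookup π (ι a) ≡ f a)
⊆tabulate {zero}  f s = (λ ()) , (λ ()) , λ ()
⊆tabulate {suc n} f (y ∷ʳ s) =
  let ι , mono , eq = ⊆tabulate f s in suc ∘ ι , (λ a b a<b → s≤s (mono a b a<b)) , eq
⊆tabulate {suc n} f (refl ∷ s) =
  let ι , mono , eq = ⊆tabulate (f ∘ suc) s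
  in (λ { zero → zero ; (suc a) → suc (ι a) })
   , (λ { zero (suc b) _ → s≤s z≤n ; (suc a) (suc b) (s≤s a<b) → s≤s (mono a b a<b) })
   , (λ { zero → refl ; (suc a) → eq a })

relabel : ℕ → ℕ → ℕ → ℕ
relabel p q 1 = p
relabel p q _ = q

-- Both letters have to occur so that the values p < q playing their roles can be read off any
-- occurrence.
Binary : Word → Set
Binary ρ = All (λ r → r ≡ 1 ⊎ r ≡ 2) ρ × 1 ∈ ρ × 2 ∈ ρ

-- Take p and q to be the values at one 1 and one 2 of the pattern. Equal pattern letters exclude
-- both strict inequalities between the chosen values, so every other 1 also has value p and every
-- other 2 value q.
contains⇒⊆ : ∀ {π ρ} → Binary ρ → Contains π ρ →
  ∃[ p ] ∃[ q ] p < q × map (relabel p q) ρ ⊆ π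
contains⇒⊆ {π} {ρ} (bin , 1∈ρ , 2∈ρ) (ι , mono , iso) =
  f i₁ , f i₂ , f₁<f₂ , subst (_⊆ π) eq (tabulate⊆ π ι mono)
  where
  i₁ = Any.index 1∈ρ
  i₂ = Any.index 2∈ρ
  f = lookup π ∘ ι
  ρ₁ : lookup ρ i₁ ≡ 1
  ρ₁ = sym (lookup-index 1∈ρ)
  ρ₂ : lookup ρ i₂ ≡ 2
  ρ₂ = sym (lookup-index 2∈ρ)
  f₁<f₂ : f i₁ < f i₂
  f₁<f₂ = Equivalence.from (proj₁ (iso i₁ i₂)) (subst₂ _<_ (sym ρ₁) (sym ρ₂) ≤-refl)
  constant : ∀ a b → lookup ρ a ≡ lookup ρ b → f a ≡ f b
  constant a b ρa≡ρb = ≤-antisym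
    (≮⇒≥ λ fb<fa → <-irrefl (sym ρa≡ρb) (Equivalence.to (proj₂ (iso a b)) fb<fa))
    (≮⇒≥ λ fa<fb → <-irrefl ρa≡ρb (Equivalence.to (proj₁ (iso a b)) fa<fb))
  value : ∀ a → f a ≡ relabel (f i₁) (f i₂) (lookup ρ a)
  value a with All.lookup bin (∈-lookup {xs = ρ} a)
  ... | inj₁ ρa≡1 rewrite ρa≡1 = constant a i₁ (trans ρa≡1 (sym ρ₁))
  ... | inj₂ ρa≡2 rewrite ρa≡2 = constant a i₂ (trans ρa≡2 (sym ρ₂))
  eq : tabulate f ≡ map (relabel (f i₁) (f i₂)) ρ
  eq = trans (tabulate-cong value)
    (trans (sym (map-tabulate (lookup ρ) _)) (cong (map _) (tabulate-lookup ρ)))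

⊆⇒contains : ∀ {π ρ p q} → Binary ρ → p < q → map (relabel p q) ρ ⊆ π → Contains π ρ
⊆⇒contains {π} {ρ} {p} {q} (bin , _) p<q s =
  let ι , mono , eq = ⊆tabulate (relabel p q ∘ lookup ρ) (subst (_⊆ π) tab s)
  in ι , mono , λ a b → order (eq a) (eq b) , order (eq b) (eq a)
  where
  tab : map (relabel p q) ρ ≡ tabulate (relabel p q ∘ lookup ρ)
  tab = trans (cong (map _) (sym (tabulate-lookup ρ))) (map-tabulate (lookup ρ) _)
  order′ : ∀ {r s} → r ≡ 1 ⊎ r ≡ 2 → s ≡ 1 ⊎ s ≡ 2 → relabel p q r < relabel p q s ⇔ r < s
  order′ (inj₁ refl) (inj₁ refl) = mk⇔ (⊥-elim ∘ <-irrefl refl) (⊥-elim ∘ <-irrefl refl)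
  order′ (inj₁ refl) (inj₂ refl) = mk⇔ (λ _ → ≤-refl) (λ _ → p<q)
  order′ (inj₂ refl) (inj₁ refl) = mk⇔ (⊥-elim ∘ <-asym p<q) (⊥-elim ∘ <-asym {1} {2} ≤-refl)
  order′ (inj₂ refl) (inj₂ refl) = mk⇔ (⊥-elim ∘ <-irrefl refl) (⊥-elim ∘ <-irrefl refl)
  order : ∀ {a b x y} → x ≡ relabel p q (lookup ρ a) → y ≡ relabel p q (lookup ρ b) →
    x < y ⇔ lookup ρ a < lookup ρ b
  order {a} {b} refl refl =
    order′ (All.lookup bin (∈-lookup {xs = ρ} a)) (All.lookup bin (∈-lookup {xs = ρ} b))

-- Generating trees of insertions

-- The accumulator allows counting from any position on: these are the cuts of `u ++ v` that do not
-- fall inside `u`, from left to right.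
splitsFrom : Word → Word → List (Word × Word)
splitsFrom u []      = (u , []) ∷ []
splitsFrom u (y ∷ v) = (u , y ∷ v) ∷ splitsFrom (u ++ y ∷ []) v

∈-splitsFrom⁻ : ∀ {a b} u v → (a , b) ∈ splitsFrom u v → a ++ b ≡ u ++ v
∈-splitsFrom⁻ u []      (here refl) = refl
∈-splitsFrom⁻ u (y ∷ v) (here refl) = refl
∈-splitsFrom⁻ u (y ∷ v) (there s)   =
  trans (∈-splitsFrom⁻ (u ++ y ∷ []) v s) (++-assoc u (y ∷ []) v)

∈-splitsFrom⁺ : ∀ u a b → (u ++ a , b) ∈ splitsFrom u (a ++ b)
∈-splitsFrom⁺ u []      []      rewrite ++-identityʳ u = here refl
∈-splitsFrom⁺ u []      (y ∷ b) rewrite ++-identityʳ u = here refl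
∈-splitsFrom⁺ u (y ∷ a) b = there (subst (λ t → (t , b) ∈ splitsFrom (u ++ y ∷ []) (a ++ b))
  (++-assoc u (y ∷ []) a) (∈-splitsFrom⁺ (u ++ y ∷ []) a b))

splitsFrom-length : ∀ u v → All (λ s → length u ≤ length (proj₁ s)) (splitsFrom u v)
splitsFrom-length u []      = ≤-refl ∷ []
splitsFrom-length u (y ∷ v) = ≤-refl ∷
  All.map (≤-trans (≤-trans (m≤m+n _ _) (≤-reflexive (sym (length-++ u)))))
    (splitsFrom-length (u ++ y ∷ []) v)

splitsFrom-increasing : ∀ u v →
  AllPairs (λ s t → length (proj₁ s) < length (proj₁ t)) (splitsFrom u v)
splitsFrom-increasing u []      = [] ∷ []
splitsFrom-increasing u (y ∷ v) =
  All.map (≤-trans (≤-reflexive (trans (+-comm 1 (length u)) (sym (length-++ u)))))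
    (splitsFrom-length (u ++ y ∷ []) v)
  ∷ splitsFrom-increasing (u ++ y ∷ []) v

module _ {A B : Set} where

  -- The map `r` recovers the parent from a child, so different parents have disjoint lists of
  -- children.
  concatMap-unique : (f : A → List B) (r : B → A) → ∀ {xs} → Unique xs →
    All (λ x → Unique (f x)) xs → All (λ x → ∀ y → y ∈ f x → r y ≡ x) xs →
    Unique (concatMap f xs)
  concatMap-unique f r {[]}     []       _         _        = []
  concatMap-unique f r {x ∷ xs} (x∉xs ∷ uxs) (ux ∷ us) (rx ∷ rs) =
    Unique.++⁺ ux (concatMap-unique f r uxs us rs) λ (y∈fx , y∈) →
      disjoint x∉xs rs (rx _ y∈fx) (∈-concatMap⁻ f y∈)
    where
    disjoint : ∀ {xs y} → All (x ≢_) xs → All (λ x → ∀ y → y ∈ f x → r y ≡ x) xs →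
      r y ≡ x → ¬ Any (λ x → y ∈ f x) xs
    disjoint (x≢z ∷ _)  (rz ∷ _)  eq (here y∈)  = x≢z (trans (sym eq) (rz _ y∈))
    disjoint (_ ∷ x∉xs) (_ ∷ rs) eq (there y∈) = disjoint x∉xs rs eq y∈

  -- The principle of a succession rule: if the labels of the children depend only on the label of
  -- the parent, then the labels of a generation determine those of the next. Here `h` and `g` are
  -- the labels, `f` gives the children and `k` is the rule.
  map-concatMap-↭ : {C : Set} (g : B → C) (h : A → C) (f : A → List B) (k : C → List C) → ∀ {xs} →
    All (λ x → map g (f x) ↭ k (h x)) xs → map g (concatMap f xs) ↭ concatMap k (map h xs)
  map-concatMap-↭ g h f k {[]}     []       = ↭-refl
  map-concatMap-↭ g h f k {x ∷ xs} (p ∷ ps) =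
    ↭-trans (↭-reflexive (map-++ g (f x) (concatMap f xs)))
      (↭.++⁺ p (map-concatMap-↭ g h f k ps))

concatMap-↭ : {A B : Set} (f : A → List B) → ∀ {xs ys} → xs ↭ ys → concatMap f xs ↭ concatMap f ys
concatMap-↭ f p = ∼bag⇒↭ (>>=-cong (↭⇒∼bag p) (λ x → K-refl))

-- The letter c + 1 occurs n + 1 times, so that every multiplicity is positive.
Multiplicities : ℕ → List ℕ → Word → Set
Multiplicities c []       w = w ≡ []
Multiplicities c (n ∷ ns) w = All (c <_) w × occurrences (suc c) w ≡ suc n × Multiplicities (suc c) ns (remove (suc c) w)

Multiplicities-above : ∀ {c} ns {w} → Multiplicities c ns w → All (c <_) w
Multiplicities-above []       refl        = []
Multiplicities-above (n ∷ ns) (above , _) = above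

above-# : ∀ {x w} → All (x <_) w → x # w
above-# = All.map <⇒≢

InRange : ℕ → ℕ → Word → Set
InRange c k = All (λ y → c < y × y ≤ c + k)

occurrences⇒Multiplicities : ∀ c k (f : Fin k → ℕ) w → InRange c k w →
  (∀ i → occurrences (suc (c + toℕ i)) w ≡ suc (f i)) → Multiplicities c (tabulate f) w
occurrences⇒Multiplicities c zero    f []      _             _   = refl
occurrences⇒Multiplicities c zero    f (y ∷ w) ((c<y , y≤c) ∷ _) _ =
  ⊥-elim (<⇒≱ c<y (subst (y ≤_) (+-identityʳ c) y≤c))
occurrences⇒Multiplicities c (suc k) f w range occ =
    All.map proj₁ range
  , trans (cong (λ z → occurrences (suc z) w) (sym (+-identityʳ c))) (occ zero)
  , occurrences⇒Multiplicities (suc c) k (f ∘ suc) (remove (suc c) w)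
      (All.zipWith (λ {y} ((c<y , y≤) , y≢) → ≤∧≢⇒< c<y y≢ , subst (y ≤_) (+-suc c k) y≤)
        (All-remove⁺ (suc c) w range , #-remove (suc c) w))
      λ i → trans (occ-remove w (<⇒≢ (s≤s (m≤m+n (suc c) (toℕ i))) ∘ sym))
              (trans (cong (λ z → occurrences (suc z) w) (sym (+-suc c (toℕ i)))) (occ (suc i)))

Multiplicities⇒occurrences : ∀ c k (f : Fin k → ℕ) w → Multiplicities c (tabulate f) w →
  InRange c k w × (∀ i → occurrences (suc (c + toℕ i)) w ≡ suc (f i))
Multiplicities⇒occurrences c zero    f w refl = [] , λ ()
Multiplicities⇒occurrences c (suc k) f w (_ , occ₀ , mp) =
  let range , occ = Multiplicities⇒occurrences (suc c) k (f ∘ suc) (remove (suc c) w) mp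
  in All-remove⁻ w (≤-refl , subst (c <_) (sym (+-suc c k)) (s≤s (m≤m+n c k)))
       (All.map (λ {y} (c<y , y≤) → <-trans ≤-refl c<y , subst (y ≤_) (sym (+-suc c k)) y≤) range)
   , λ { zero → trans (cong (λ z → occurrences (suc z) w) (+-identityʳ c)) occ₀
       ; (suc i) → trans (cong (λ z → occurrences (suc z) w) (+-suc c (toℕ i)))
           (trans (sym (occ-remove w (<⇒≢ (s≤s (m≤m+n (suc c) (toℕ i))) ∘ sym))) (occ i)) }

predMults : Multiset → List ℕ
predMults S = tabulate (pred ∘ mult S)

suc-pred-mult : ∀ S i → suc (pred (mult S i)) ≡ mult S i
suc-pred-mult S i = suc-pred (mult S i) ⦃ >-nonZero (mult≥1 S i) ⦄

isMultipermutation⇔Multiplicities : ∀ S w → IsMultipermutation S w ⇔ Multiplicities 0 (predMults S) w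
isMultipermutation⇔Multiplicities S w = mk⇔
  (λ (range , occ) → occurrences⇒Multiplicities 0 (k S) _ w range
     λ i → trans (occ i) (sym (suc-pred-mult S i)))
  (λ mp → let range , occ = Multiplicities⇒occurrences 0 (k S) _ w mp
          in range , λ i → trans (occ i) (suc-pred-mult S i))

-- The numbers of allowed cuts after adding n + 1 copies of a letter, given m cuts before.
nexts : ℕ → ℕ → List ℕ
nexts 0             m = replicate m (suc m)
nexts 1             m = replicate m (2 + m)
nexts (suc (suc _)) m = map (3 +_) (upTo m)

-- The root is the empty word, whose single cut is allowed, hence the label 1. The head of the list
-- belongs to the smallest letter, which is added last.
profile : List ℕ → List ℕ
profile []       = 1 ∷ []
profile (n ∷ ns) = concatMap (nexts n) (profile ns)

module _ {Allowed : Word → Word → Set} (allowed? : ∀ u v → Dec (Allowed u v)) where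

  allowedSplits : Word → Word → List (Word × Word)
  allowedSplits u v = filter (uncurry allowed?) (splitsFrom u v)

  splitCount : Word → Word → ℕ
  splitCount u v = length (allowedSplits u v)

-- Since the cut is marked by the first x, different cuts of a word yield different new words.
first-occurrence : ∀ {x u u′ t t′} → x # u → x # u′ → u ++ x ∷ t ≡ u′ ++ x ∷ t′ → u ≡ u′
first-occurrence []          []            _  = refl
first-occurrence []          (x≢y ∷ _)     eq = ⊥-elim (x≢y (∷-injectiveˡ eq))
first-occurrence (x≢y ∷ _)   []            eq = ⊥-elim (x≢y (sym (∷-injectiveˡ eq)))
first-occurrence (_ ∷ x#u)   (_ ∷ x#u′)    eq =
  cong₂ _∷_ (∷-injectiveˡ eq) (first-occurrence x#u x#u′ (∷-injectiveʳ eq))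

-- The common interface of the two classes. One copy of x marks the cut, and `body` distributes the
-- n further copies over the right part.
record Insertion (P : PatternSet) : Set₁ where
  field
    Allowed  : Word → Word → Set
    allowed? : ∀ u v → Dec (Allowed u v)
    body     : ℕ → ℕ → Word → Word

  siteCount : Word → ℕ
  siteCount = splitCount allowed? []

  insert : ℕ → ℕ → Word × Word → Word
  insert x n (u , v) = u ++ x ∷ body x n v

  insertions : ℕ → ℕ → Word → List Word
  insertions x n w = map (insert x n) (allowedSplits allowed? [] w)

  field
    allowed-[]  : Allowed [] []
    avoids-[]   : AvoidsAll P []
    remove-body : ∀ {x v} n → x # v → remove x (body x n v) ≡ v
    occ-body    : ∀ {x v} n → x # v → occurrences x (body x n v) ≡ n
    avoids⁻     : ∀ {x n w} → All (x ≤_) w → occurrences x w ≡ suc n → AvoidsAll P w →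
      ∃[ u ] ∃[ v ] u ++ v ≡ remove x w × w ≡ insert x n (u , v) × Allowed u v × AvoidsAll P (u ++ v)
    avoids⁺     : ∀ {x u v} n → All (x <_) (u ++ v) → Allowed u v → AvoidsAll P (u ++ v) →
      AvoidsAll P (insert x n (u , v))
    -- The rule `nexts` is fixed in advance and independent of P; this is what makes the trees
    -- comparable.
    siteCounts       : ∀ {x w} n → x # w → map siteCount (insertions x n w) ↭ nexts n (siteCount w)

  generated : ℕ → List ℕ → List Word
  generated c []       = [] ∷ []
  generated c (n ∷ ns) = concatMap (insertions (suc c) n) (generated (suc c) ns)

  ∈-insertions⁻ : ∀ x n w′ {w} → w ∈ insertions x n w′ →
    ∃[ u ] ∃[ v ] u ++ v ≡ w′ × w ≡ insert x n (u , v) × Allowed u v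
  ∈-insertions⁻ x n w′ w∈ with ∈-map⁻ (insert x n) w∈
  ... | (u , v) , s∈ , eq with ∈-filter⁻ (uncurry allowed?) {xs = splitsFrom [] w′} s∈
  ...   | s∈′ , ok = u , v , ∈-splitsFrom⁻ [] w′ s∈′ , eq , ok

  ∈-insertions⁺ : ∀ x n {u v} → Allowed u v → insert x n (u , v) ∈ insertions x n (u ++ v)
  ∈-insertions⁺ x n {u} {v} ok =
    ∈-map⁺ (insert x n) (∈-filter⁺ (uncurry allowed?) (∈-splitsFrom⁺ [] u v) ok)

  remove-insert : ∀ {x} n u v → x # u ++ v → remove x (insert x n (u , v)) ≡ u ++ v
  remove-insert {x} n u v x# =
    trans (remove-first u _ (All.++⁻ˡ u x#)) (cong (u ++_) (remove-body n (All.++⁻ʳ u x#)))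

  occ-insert : ∀ {x} n u v → x # u ++ v → occurrences x (insert x n (u , v)) ≡ suc n
  occ-insert {x} n u v x# =
    trans (occ-++ x u _) (trans (cong₂ _+_ (occ-# (All.++⁻ˡ u x#)) (occ-∷≡ x _))
      (cong suc (occ-body n (All.++⁻ʳ u x#))))

  ∈-generated⁻ : ∀ c ns {w} → w ∈ generated c ns → Multiplicities c ns w × AvoidsAll P w
  ∈-generated⁻ c []       (here refl) = refl , avoids-[]
  ∈-generated⁻ c (n ∷ ns) {w} w∈
    with w′ , w′∈ , w∈′ ← find (∈-concatMap⁻ (insertions (suc c) n) {xs = generated (suc c) ns} w∈)
    with u , v , refl , refl , ok ← ∈-insertions⁻ (suc c) n w′ w∈′ =
    let mp , avoids = ∈-generated⁻ (suc c) ns w′∈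
        above = Multiplicities-above ns mp
        removed = remove-insert n u v (above-# above)
    in ( All-remove⁻ w ≤-refl (subst (All (c <_)) (sym removed) (All.map (<-trans ≤-refl) above))
       , occ-insert n u v (above-# above)
       , subst (Multiplicities (suc c) ns) (sym removed) mp )
     , avoids⁺ n above ok avoids

  ∈-generated⁺ : ∀ c ns {w} → Multiplicities c ns w → AvoidsAll P w → w ∈ generated c ns
  ∈-generated⁺ c []       refl avoids = here refl
  ∈-generated⁺ c (n ∷ ns) {w} (above , occ , mp) avoids =
    let u , v , uv≡ , w≡ , ok , avoids′ = avoids⁻ above occ avoids
    in ∈-concatMap⁺ (insertions (suc c) n) (lose
         (∈-generated⁺ (suc c) ns (subst (Multiplicities (suc c) ns) (sym uv≡) mp) avoids′)
         (subst (_∈ insertions (suc c) n (u ++ v)) (sym w≡) (∈-insertions⁺ (suc c) n ok)))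

  above-generated : ∀ c ns → All (All (c <_)) (generated c ns)
  above-generated c ns = All.tabulate λ w∈ → Multiplicities-above ns (proj₁ (∈-generated⁻ c ns w∈))

  -- Deleting x recovers the parent, and the position of the first x recovers the cut.
  generated-unique : ∀ c ns → Unique (generated c ns)
  generated-unique c []       = [] ∷ []
  generated-unique c (n ∷ ns) = concatMap-unique (insertions x n) (remove x)
    (generated-unique x ns)
    (All.map (λ {w} above → insertions-unique w (above-# above)) (above-generated x ns))
    (All.map (λ above → removes (above-# above)) (above-generated x ns))
    where
    x = suc c
    removes : ∀ {w} → x # w → ∀ y → y ∈ insertions x n w → remove x y ≡ w
    removes {w} x#w _ y∈ with u , v , refl , refl , _ ← ∈-insertions⁻ x n w y∈ = remove-insert n u v x#w

    insertions-unique : ∀ w → x # w → Unique (insertions x n w)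
    insertions-unique w x#w = AllPairs.map⁺ (distinct
      (All.filter⁺ (uncurry allowed?) (All.tabulate λ {s} s∈ →
         All.++⁻ˡ (proj₁ s) (subst (x #_) (sym (∈-splitsFrom⁻ [] w s∈)) x#w)))
      (AllPairs.filter⁺ (uncurry allowed?) (splitsFrom-increasing [] w)))
      where
      distinct : ∀ {ss} → All (λ s → x # proj₁ s) ss →
        AllPairs (λ s t → length (proj₁ s) < length (proj₁ t)) ss →
        AllPairs (λ s t → insert x n s ≢ insert x n t) ss
      distinct []         []         = []
      distinct (x#u ∷ x#) (u< ∷ inc) =
        All.zipWith (λ { {u′ , _} (x#u′ , u<u′) eq → <⇒≢ u<u′
          (cong length (first-occurrence x#u x#u′ eq)) })
          (x# , u<)
        ∷ distinct x# inc

  siteCount-generated : ∀ c ns → map siteCount (generated c ns) ↭ profile ns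
  siteCount-generated c []       = ↭-reflexive
    (cong (λ n → length n ∷ []) (filter-accept (uncurry allowed?) {[] , []} {[]} allowed-[]))
  siteCount-generated c (n ∷ ns) = ↭-trans
    (map-concatMap-↭ siteCount siteCount (insertions (suc c) n) (nexts n)
      (All.map (λ above → siteCounts n (above-# above)) (above-generated (suc c) ns)))
    (concatMap-↭ (nexts n) (siteCount-generated (suc c) ns))

  -- Two duplicate-free lists with the same members have equal length. The right-hand side depends
  -- on the multiplicities alone, so any two pattern sets with an `Insertion` are m-equivalent.
  av≡length-profile : ∀ S → av S P ≡ length (profile (predMults S))
  av≡length-profile S = begin
    av S P                               ≡⟨ ↭.↭-length (∼bag⇒↭ (unique∧set⇒bag
      (Unique.filter⁺ (avoidsAll? P) (multipermutations-unique S)) (generated-unique 0 ns) (mk⇔ to from))) ⟩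
    length (generated 0 ns)              ≡⟨ length-map siteCount (generated 0 ns) ⟨
    length (map siteCount (generated 0 ns))   ≡⟨ ↭.↭-length (siteCount-generated 0 ns) ⟩
    length (profile ns)                  ∎
    where
    open ≡-Reasoning
    ns = predMults S
    to : ∀ {w} → w ∈ filter (avoidsAll? P) (multipermutations S) → w ∈ generated 0 ns
    to {w} w∈ with w∈′ , avoids ← ∈-filter⁻ (avoidsAll? P) {xs = multipermutations S} w∈ =
      ∈-generated⁺ 0 ns (Equivalence.to (isMultipermutation⇔Multiplicities S w)
        (Equivalence.to (∈-multipermutations S w) w∈′)) avoids
    from : ∀ {w} → w ∈ generated 0 ns → w ∈ filter (avoidsAll? P) (multipermutations S)
    from {w} w∈ with mp , avoids ← ∈-generated⁻ 0 ns w∈ =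
      ∈-filter⁺ (avoidsAll? P) (Equivalence.from (∈-multipermutations S w)
        (Equivalence.from (isMultipermutation⇔Multiplicities S w) mp)) avoids

insertion⇒~ : ∀ {P Q} → Insertion P → Insertion Q → P ~ Q
insertion⇒~ I J S =
  trans (Insertion.av≡length-profile I S) (sym (Insertion.av≡length-profile J S))

-- Counting allowed cuts

module _ {Allowed : Word → Word → Set} (allowed? : ∀ u v → Dec (Allowed u v)) where

  private
    count = splitCount allowed?

  splitCount-accept : ∀ {u y v} → Allowed u (y ∷ v) → count u (y ∷ v) ≡ suc (count (u ++ y ∷ []) v)
  splitCount-accept {u} {y} {v} ok = cong length (filter-accept (uncurry allowed?) {u , y ∷ v} ok)

  splitCount-reject : ∀ {u y v} → ¬ Allowed u (y ∷ v) → count u (y ∷ v) ≡ count (u ++ y ∷ []) v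
  splitCount-reject {u} {y} {v} ¬ok = cong length (filter-reject (uncurry allowed?) {u , y ∷ v} ¬ok)

  -- The leading cut contributes equally to both counts. The offsets `i` and `j` carry a known
  -- difference through a simultaneous induction on two words.
  splitCount-∷ : ∀ {u y v u′ y′ v′} i j → Allowed u (y ∷ v) ⇔ Allowed u′ (y′ ∷ v′) →
    i + count (u ++ y ∷ []) v ≡ j + count (u′ ++ y′ ∷ []) v′ →
    i + count u (y ∷ v) ≡ j + count u′ (y′ ∷ v′)
  splitCount-∷ {u} {y} {v} {u′} {y′} {v′} i j same eq with allowed? u (y ∷ v)
  ... | yes ok = trans (+-suc i _)
          (trans (cong suc eq) (trans (sym (+-suc j _))
            (cong (j +_) (sym (splitCount-accept (Equivalence.to same ok))))))
  ... | no ¬ok = trans eq (cong (j +_) (sym (splitCount-reject (¬ok ∘ Equivalence.from same))))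

  -- Counted from an allowed cut on, that cut included, the number of allowed cuts drops by exactly
  -- one at each next allowed cut, so it runs through m, ..., 1.
  counts-descend : ∀ u v →
    map (uncurry count) (allowedSplits allowed? u v) ≡ map suc (downFrom (count u v))
  counts-descend u []      with allowed? u []
  ... | yes ok = cong (_∷ []) (cong length (filter-accept (uncurry allowed?) {u , []} ok))
  ... | no  _  = refl
  counts-descend u (y ∷ v) with allowed? u (y ∷ v)
  ... | yes ok = cong₂ _∷_ (splitCount-accept ok) (counts-descend (u ++ y ∷ []) v)
  ... | no  _  = counts-descend (u ++ y ∷ []) v

allowedSplits-sound : {Allowed : Word → Word → Set} (allowed? : ∀ u v → Dec (Allowed u v)) → ∀ w →
  All (λ s → proj₁ s ++ proj₂ s ≡ w × uncurry Allowed s) (allowedSplits allowed? [] w)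
allowedSplits-sound allowed? w = All.zip
  ( All.filter⁺ (uncurry allowed?) (All.tabulate (∈-splitsFrom⁻ [] w))
  , All.all-filter (uncurry allowed?) (splitsFrom [] w))

map-const-local : ∀ {A : Set} (g : A → ℕ) c {xs} → All (λ x → g x ≡ c) xs → map g xs ≡ replicate (length xs) c
map-const-local g c []       = refl
map-const-local g c (p ∷ ps) = cong₂ _∷_ p (map-const-local g c ps)

-- Subtracting the falling values m - 1, ..., 0 gives rising ones, without truncation. The offset
-- `b` absorbs the growth of `m` in the induction.
countdown-∸ : ∀ b m → map (λ j → b + m ∸ j) (downFrom m) ≡ map (λ j → suc (b + j)) (upTo m)
countdown-∸ b zero    = refl
countdown-∸ b (suc m) = cong₂ _∷_
  (trans (cong (_∸ m) (+-suc b m)) (trans (m+n∸n≡m (suc b) m) (cong suc (sym (+-identityʳ b)))))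
  (begin
    map (λ j → b + suc m ∸ j) (downFrom m)     ≡⟨ cong (λ k → map (λ j → k ∸ j) (downFrom m)) (+-suc b m) ⟩
    map (λ j → suc b + m ∸ j) (downFrom m)     ≡⟨ countdown-∸ (suc b) m ⟩
    map (λ j → suc (suc b + j)) (upTo m)       ≡⟨ map-cong (λ j → cong suc (sym (+-suc b j))) (upTo m) ⟩
    map (λ j → suc (b + suc j)) (upTo m)       ≡⟨ map-upTo _ m ⟩
    applyUpTo (λ j → suc (b + suc j)) m        ≡⟨ map-applyUpTo suc (λ j → suc (b + j)) m ⟨
    map (λ j → suc (b + j)) (applyUpTo suc m)  ∎)
  where open ≡-Reasoning

-- An occurrence of a pattern with letters 1 and 2 that involves the smallest letter x of w uses it as the 1.
avoids-remove⁻ : ∀ ρ x w → Binary ρ → Avoids w ρ →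
  Avoids (remove x w) ρ × (∀ {q} → x < q → ¬ map (relabel x q) ρ ⊆ w)
avoids-remove⁻ ρ x w bin avoids =
    (λ c → let _ , _ , p<q , s = contains⇒⊆ bin c
           in avoids (⊆⇒contains bin p<q (⊆-trans s (filter-⊆ (≢? x) w))))
  , λ x<q s → avoids (⊆⇒contains bin x<q s)

-- In an occurrence with values p < q, either p is x, which the last hypothesis excludes, or x < p
-- and the occurrence survives the deletion of x.
avoids-remove⁺ : ∀ ρ {x w w′} → Binary ρ → All (x ≤_) w → remove x w ≡ w′ →
  Avoids w′ ρ → (∀ {q} → x < q → ¬ map (relabel x q) ρ ⊆ w) → Avoids w ρ
avoids-remove⁺ ρ {x} {w} bin@(letters , 1∈ρ , _) least refl avoids none c
  with p , q , p<q , s ← contains⇒⊆ bin c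
  with x ≟ p
... | yes refl = none p<q s
... | no x≢p   = avoids (⊆⇒contains bin p<q (⊆-remove x# s))
  where
  x<p : x < p
  x<p = ≤∧≢⇒< (All.lookup (All-resp-⊆ s least) (∈-map⁺ (relabel p q) 1∈ρ)) x≢p
  x# : x # map (relabel p q) ρ
  x# = All.map⁺ (All.map (λ { (inj₁ refl) → x≢p ; (inj₂ refl) → <⇒≢ (<-trans x<p p<q) }) letters)

-- The positions of the copies of the smallest letter

split-first : ∀ {x n} w → occurrences x w ≡ suc n →
  ∃[ u ] ∃[ t ] w ≡ u ++ x ∷ t × x # u × occurrences x t ≡ n
split-first {x} (y ∷ w) eq with x ≟ y
... | yes refl = [] , w , refl , [] , suc-injective (trans (sym (occ-∷≡ x w)) eq)
... | no x≢y   =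
  let u , t , w≡ , x#u , occ = split-first w (trans (sym (occ-∷≢ w x≢y)) eq)
  in y ∷ u , t , cong (y ∷_) w≡ , x≢y ∷ x#u , occ

-- Applied to what follows the first x in a word avoiding 112: a larger letter after another x would
-- complete the pattern.
sorted-descending : ∀ {x} t → All (x ≤_) t → (∀ {q} → x < q → ¬ x ∷ q ∷ [] ⊆ t) →
  t ≡ remove x t ++ replicate (occurrences x t) x
sorted-descending []      _              _    = refl
sorted-descending {x} (y ∷ t) (x≤y ∷ least) none
  with x ≟ y | sorted-descending t least (λ x<q s → none x<q (y ∷ʳ s))
... | yes refl | ih
  rewrite remove-∷≡ x t | occ-∷≡ x t
        -- Behind an x there are only copies of x, so the rest becomes empty when they are deleted.
        | filter-none (≢? x) {t} (All.tabulate λ z∈ x≢z →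
            none (≤∧≢⇒< (All.lookup least z∈) x≢z) (refl ∷ from∈ z∈)) = cong (x ∷_) ih
... | no x≢y | ih rewrite remove-∷≢ t x≢y | occ-∷≢ t x≢y = cong (y ∷_) ih

-- Applied to what follows the first x in a word avoiding 121: an x after a larger letter would
-- complete the pattern.
sorted-ascending : ∀ {x} t → All (x ≤_) t → (∀ {q} → x < q → ¬ q ∷ x ∷ [] ⊆ t) →
  t ≡ replicate (occurrences x t) x ++ remove x t
sorted-ascending []      _              _    = refl
sorted-ascending {x} (y ∷ t) (x≤y ∷ least) none with x ≟ y
... | yes refl rewrite remove-∷≡ x t | occ-∷≡ x t =
  cong (x ∷_) (sorted-ascending t least λ x<q s → none x<q (y ∷ʳ s))
... | no x≢y = trans (sym (remove-# x#))
  (cong (λ n → replicate n x ++ remove x (y ∷ t)) (sym (occ-# x#)))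
  where
  x# : x # y ∷ t
  x# = x≢y ∷ All.tabulate λ { z∈ refl → none (≤∧≢⇒< x≤y x≢y) (refl ∷ from∈ z∈) }

p112 p2122 p121 p1222 : Word
p112  = 1 ∷ 1 ∷ 2 ∷ []
p2122 = 2 ∷ 1 ∷ 2 ∷ 2 ∷ []
p121  = 1 ∷ 2 ∷ 1 ∷ []
p1222 = 1 ∷ 2 ∷ 2 ∷ 2 ∷ []

binary-112 : Binary p112
binary-112 = inj₁ refl ∷ inj₁ refl ∷ inj₂ refl ∷ [] , here refl , there (there (here refl))

binary-2122 : Binary p2122
binary-2122 = inj₂ refl ∷ inj₁ refl ∷ inj₂ refl ∷ inj₂ refl ∷ [] , there (here refl) , here refl

binary-121 : Binary p121
binary-121 = inj₁ refl ∷ inj₂ refl ∷ inj₁ refl ∷ [] , here refl , there (here refl)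

binary-1222 : Binary p1222
binary-1222 = inj₁ refl ∷ inj₂ refl ∷ inj₂ refl ∷ inj₂ refl ∷ [] , here refl , there (here refl)

avoids-[] : ∀ ρ → Binary ρ → Avoids [] ρ
avoids-[] ρ (_ , 1∈ρ , _) (ι , _) with () ← ι (Any.index 1∈ρ)

AtMost : ℕ → Word → ℕ → Set
AtMost m v y = occurrences y v ≤ m

AtMost-remove : ∀ {m x y} v → x ≢ y → AtMost m v y ⇔ AtMost m (remove x v) y
AtMost-remove v x≢y = mk⇔ (subst (_≤ _) (sym (occ-remove v (x≢y ∘ sym))))
                           (subst (_≤ _) (occ-remove v (x≢y ∘ sym)))

All-AtMost-remove : ∀ {m x u} v → x # u → All (AtMost m v) u ⇔ All (AtMost m (remove x v)) u
All-AtMost-remove v x#u = mk⇔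
  (λ ok → All.zipWith (λ (p , q) → Equivalence.to (AtMost-remove v p) q) (x#u , ok))
  (λ ok → All.zipWith (λ (p , q) → Equivalence.from (AtMost-remove v p) q) (x#u , ok))

-- 112 and 2122

-- A letter y of u with two copies in v would give y x y y, a 2122, once x stands at the cut.
Allowed₁ : Word → Word → Set
Allowed₁ u v = All (AtMost 1 v) u

allowed₁? : ∀ u v → Dec (Allowed₁ u v)
allowed₁? u v = All.all? (λ y → occurrences y v ≤? 1) u

body₁ : ℕ → ℕ → Word → Word
body₁ x n v = v ++ replicate n x

remove-body₁ : ∀ {x v} n → x # v → remove x (body₁ x n v) ≡ v
remove-body₁ {x} {v} n x#v = trans (remove-++ x v _)
  (trans (cong₂ _++_ (remove-# x#v) (remove-replicate x n)) (++-identityʳ v))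

occ-body₁ : ∀ {x v} n → x # v → occurrences x (body₁ x n v) ≡ n
occ-body₁ {x} {v} n x#v = trans (occ-++ x v _) (cong₂ _+_ (occ-# x#v) (occ-replicate x n))

count₁ : Word → Word → ℕ
count₁ = splitCount allowed₁?

-- The splits strictly inside u are unaffected by fresh letters to their right.
count₁-prefix : ∀ {x} u₀ u t → x # u₀ ++ u →
  count₁ (u₀ ++ u) (remove x t) + count₁ u₀ (u ++ t) ≡ count₁ (u₀ ++ u) t + count₁ u₀ (u ++ remove x t)
count₁-prefix {x} u₀ []      t x# rewrite ++-identityʳ u₀ = +-comm (count₁ u₀ (remove x t)) _
count₁-prefix {x} u₀ (y ∷ u) t x# =
  splitCount-∷ allowed₁? (count₁ (u₀ ++ y ∷ u) (remove x t)) (count₁ (u₀ ++ y ∷ u) t)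
    (subst (λ s → Allowed₁ u₀ (y ∷ u ++ t) ⇔ Allowed₁ u₀ s) removed
      (All-AtMost-remove (y ∷ u ++ t) (All.++⁻ˡ u₀ x#)))
    (subst (λ u₁ → count₁ u₁ (remove x t) + count₁ (u₀ ++ y ∷ []) (u ++ t)
                   ≡ count₁ u₁ t + count₁ (u₀ ++ y ∷ []) (u ++ remove x t))
      (++-assoc u₀ (y ∷ []) u)
      (count₁-prefix (u₀ ++ y ∷ []) u t (subst (x #_) (sym (++-assoc u₀ (y ∷ []) u)) x#)))
  where
  removed : remove x (y ∷ u ++ t) ≡ y ∷ u ++ remove x t
  removed = trans (remove-++ x (y ∷ u) t) (cong (_++ remove x t) (remove-# (All.++⁻ʳ u₀ x#)))

allowed₁-short : ∀ u v → length v ≤ 1 → Allowed₁ u v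
allowed₁-short u v v≤1 = All.tabulate λ {y} _ → ≤-trans (occ≤length y v) v≤1

count₁-[] : ∀ u → count₁ u [] ≡ 1
count₁-[] u = cong length (filter-accept (uncurry allowed₁?) {u , []} (allowed₁-short u [] z≤n))

count₁-[x] : ∀ u x → count₁ u (x ∷ []) ≡ 2
count₁-[x] u x = trans (splitCount-accept allowed₁? (allowed₁-short u (x ∷ []) ≤-refl))
  (cong suc (count₁-[] (u ++ x ∷ [])))

-- With at most one trailing x, no cut has two copies of x on its right, so copies of x on the left
-- impose nothing. Each trailing x adds one cut.
count₁-tail-short : ∀ {x n} u v → n ≤ 1 → x # v →
  count₁ u (body₁ x n v) ≡ n + count₁ (remove x u) v
count₁-tail-short u [] z≤n _ = trans (count₁-[] u) (sym (count₁-[] (remove _ u)))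
count₁-tail-short u [] (s≤s z≤n) _ = trans (count₁-[x] u _) (cong suc (sym (count₁-[] (remove _ u))))
count₁-tail-short {x} {n} u (y ∷ v) n≤1 x#@(x≢y ∷ x#v) =
  splitCount-∷ allowed₁? 0 n same
    (trans (count₁-tail-short (u ++ y ∷ []) v n≤1 x#v)
      (cong (λ u′ → n + count₁ u′ v) (trans (remove-++ x u (y ∷ []))
        (cong (remove x u ++_) (remove-# (x≢y ∷ []))))))
  where
  same : Allowed₁ u (body₁ x n (y ∷ v)) ⇔ Allowed₁ (remove x u) (y ∷ v)
  same = mk⇔
    (λ ok → subst (Allowed₁ (remove x u)) (remove-body₁ n x#)
       (Equivalence.to (All-AtMost-remove (body₁ x n (y ∷ v)) (#-remove x u)) (All-remove⁺ x u ok)))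
    (λ ok → All-remove⁻ u (subst (_≤ 1) (sym (occ-body₁ n x#)) n≤1)
       (Equivalence.from (All-AtMost-remove (body₁ x n (y ∷ v)) (#-remove x u))
         (subst (Allowed₁ (remove x u)) (sym (remove-body₁ n x#)) ok)))

-- As x already lies on the left, a cut may leave at most one x on the right. Only the cuts before
-- and after the very last x do so.
count₁-tail-long : ∀ {x} k u v → x ∈ u → count₁ u (body₁ x (2 + k) v) ≡ 2
count₁-tail-long {x} k u (y ∷ v) x∈ = trans (splitCount-reject allowed₁? λ ok →
    <⇒≱ (≤-trans (s≤s (s≤s z≤n)) many) (All.lookup ok x∈))
  (count₁-tail-long k (u ++ y ∷ []) v (∈-++⁺ˡ x∈))
  where
  many : 2 + k ≤ occurrences x (body₁ x (2 + k) (y ∷ v))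
  many = replicate⊆⇒≤occ (2 + k) x _ (++⁺ˡ (y ∷ v) ⊆-refl)
count₁-tail-long {x} k u [] x∈ = trans (splitCount-reject allowed₁? λ ok →
    <⇒≱ (subst (1 <_) (sym (occ-replicate x (2 + k))) (s≤s (s≤s z≤n))) (All.lookup ok x∈))
  (rest k)
  where
  rest : ∀ k → count₁ (u ++ x ∷ []) (replicate (suc k) x) ≡ 2
  rest zero    = count₁-[x] (u ++ x ∷ []) x
  rest (suc k) = count₁-tail-long k (u ++ x ∷ []) [] (∈-++⁺ˡ x∈)

-- Both differences `count₁ [] _ - count₁ u _` count the allowed cuts strictly to the left of the
-- insertion point, which the insertion leaves alone. The sums avoid truncated subtraction.
siteCount₁-insert : ∀ {x} n u v → x # u ++ v →
  count₁ u v + count₁ [] (u ++ x ∷ body₁ x n v) ≡ count₁ u (x ∷ body₁ x n v) + count₁ [] (u ++ v)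
siteCount₁-insert {x} n u v x# = subst (λ v′ → count₁ u v′ + count₁ [] (u ++ x ∷ body₁ x n v) ≡
    count₁ u (x ∷ body₁ x n v) + count₁ [] (u ++ v′))
  (trans (remove-∷≡ x _) (remove-body₁ n (All.++⁻ʳ u x#)))
  (count₁-prefix [] u (x ∷ body₁ x n v) (All.++⁻ˡ u x#))

count₁-at : ∀ {x} n u v → x # u ++ v → Allowed₁ u v →
  count₁ u (x ∷ body₁ x n v) ≡ suc (count₁ (u ++ x ∷ []) (body₁ x n v))
count₁-at {x} n u v x# ok = splitCount-accept allowed₁?
  (Equivalence.from (All-AtMost-remove (x ∷ body₁ x n v) (All.++⁻ˡ u x#))
    (subst (Allowed₁ u) (sym (trans (remove-∷≡ x _) (remove-body₁ n (All.++⁻ʳ u x#)))) ok))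

siteCount₁-short : ∀ {x n} u v → n ≤ 1 → x # u ++ v → Allowed₁ u v →
  count₁ [] (u ++ x ∷ body₁ x n v) ≡ suc n + count₁ [] (u ++ v)
siteCount₁-short {x} {n} u v n≤1 x# ok = +-cancelˡ-≡ (count₁ u v) _ _ (begin
  count₁ u v + count₁ [] (u ++ x ∷ body₁ x n v)          ≡⟨ siteCount₁-insert n u v x# ⟩
  count₁ u (x ∷ body₁ x n v) + m                         ≡⟨ cong (_+ m) (count₁-at n u v x# ok) ⟩
  suc (count₁ (u ++ x ∷ []) (body₁ x n v)) + m           ≡⟨ cong (λ k → suc k + m) (count₁-tail-short _ v n≤1 (All.++⁻ʳ u x#)) ⟩
  suc n + count₁ (remove x (u ++ x ∷ [])) v + m          ≡⟨ cong (λ u′ → suc n + count₁ u′ v + m) removed ⟩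
  suc n + count₁ u v + m                                 ≡⟨ cong (_+ m) (+-comm (suc n) (count₁ u v)) ⟩
  count₁ u v + suc n + m                                 ≡⟨ +-assoc (count₁ u v) (suc n) m ⟩
  count₁ u v + (suc n + m)                               ∎)
  where
  open ≡-Reasoning
  m = count₁ [] (u ++ v)
  removed : remove x (u ++ x ∷ []) ≡ u
  removed = trans (remove-first u [] (All.++⁻ˡ u x#)) (++-identityʳ u)

-- What remains are the m - `count₁ u v` cuts to the left of the insertion point, the one at that
-- point, and the last two.
siteCount₁-long : ∀ {x} k u v → x # u ++ v → Allowed₁ u v →
  count₁ [] (u ++ x ∷ body₁ x (2 + k) v) ≡ 3 + count₁ [] (u ++ v) ∸ count₁ u v
siteCount₁-long {x} k u v x# ok = trans (sym (m+n∸m≡n (count₁ u v) _)) (cong (_∸ count₁ u v) (begin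
  count₁ u v + count₁ [] (u ++ x ∷ body₁ x (2 + k) v)    ≡⟨ siteCount₁-insert (2 + k) u v x# ⟩
  count₁ u (x ∷ body₁ x (2 + k) v) + m                   ≡⟨ cong (_+ m) (count₁-at (2 + k) u v x# ok) ⟩
  suc (count₁ (u ++ x ∷ []) (body₁ x (2 + k) v)) + m     ≡⟨ cong (λ j → suc j + m)
    (count₁-tail-long k _ v (∈-++⁺ʳ u (here refl))) ⟩
  3 + m                                                  ∎))
  where
  open ≡-Reasoning
  m = count₁ [] (u ++ v)

siteCounts₁ : ∀ {x w} n → x # w →
  map (count₁ []) (map (λ s → proj₁ s ++ x ∷ body₁ x n (proj₂ s)) (allowedSplits allowed₁? [] w)) ↭
  nexts n (count₁ [] w)
siteCounts₁ {x} {w} n x#w = ↭-reflexive (trans (sym (map-∘ L)) (counts n))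
  where
  open ≡-Reasoning
  L = allowedSplits allowed₁? [] w
  m = count₁ [] w
  short : ∀ {n} → n ≤ 1 →
    map (λ s → count₁ [] (proj₁ s ++ x ∷ body₁ x n (proj₂ s))) L ≡ replicate m (suc n + m)
  short n≤1 = map-const-local _ _ (All.map
    (λ { {u , v} (refl , ok) → siteCount₁-short u v n≤1 x#w ok }) (allowedSplits-sound allowed₁? w))
  counts : ∀ n → map (λ s → count₁ [] (proj₁ s ++ x ∷ body₁ x n (proj₂ s))) L ≡ nexts n m
  counts 0             = short z≤n
  counts 1             = short ≤-refl
  counts (suc (suc k)) = begin
    map (λ s → count₁ [] (proj₁ s ++ x ∷ body₁ x (2 + k) (proj₂ s))) L
      ≡⟨ map-cong-local (All.map (λ { {u , v} (refl , ok) → siteCount₁-long k u v x#w ok })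
           (allowedSplits-sound allowed₁? w)) ⟩
    map (λ s → 3 + m ∸ uncurry count₁ s) L        ≡⟨ map-∘ L ⟩
    -- The counts from the cuts on are m, ..., 1, so the labels rise from 3 to m + 2.
    map (3 + m ∸_) (map (uncurry count₁) L)       ≡⟨ cong (map _) (counts-descend allowed₁? [] w) ⟩
    map (3 + m ∸_) (map suc (downFrom m))         ≡⟨ map-∘ (downFrom m) ⟨
    map (2 + m ∸_) (downFrom m)                   ≡⟨ countdown-∸ 2 m ⟩
    map (3 +_) (upTo m)                           ∎

P₁ : PatternSet
P₁ = p112 ∷ p2122 ∷ []

avoids₁⁻ : ∀ {x n w} → All (x ≤_) w → occurrences x w ≡ suc n → AvoidsAll P₁ w →
  ∃[ u ] ∃[ v ] u ++ v ≡ remove x w × w ≡ u ++ x ∷ body₁ x n v × Allowed₁ u v × AvoidsAll P₁ (u ++ v)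
avoids₁⁻ {x} {n} {w} least occ (a112 ∷ a2122 ∷ [])
  with r112 , none112 ← avoids-remove⁻ p112 x w binary-112 a112
  with r2122 , none2122 ← avoids-remove⁻ p2122 x w binary-2122 a2122
  with u , t , refl , x#u , refl ← split-first w occ =
  let removed = remove-first u t x#u in
    u , remove x t , sym removed
  , cong (λ s → u ++ x ∷ s) (sorted-descending t (All.tail (All.++⁻ʳ u least))
      λ x<q s → none112 x<q (++⁺ˡ u (refl ∷ s)))
  -- Two copies of y after the first x would complete y x y y.
  , All.tabulate (λ {y} y∈u → ≮⇒≥ λ 1<occ →
      none2122 (≤∧≢⇒< (All.lookup (All.++⁻ˡ u least) y∈u) (All.lookup x#u y∈u))
        (++⁺ (from∈ y∈u) (refl ∷ ⊆-trans (≤occ⇒replicate⊆ 2 y _ 1<occ) (filter-⊆ (≢? x) t))))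
  , subst (AvoidsAll P₁) removed (r112 ∷ r2122 ∷ [])

avoids₁⁺ : ∀ {x u v} n → All (x <_) (u ++ v) → Allowed₁ u v → AvoidsAll P₁ (u ++ v) →
  AvoidsAll P₁ (u ++ x ∷ body₁ x n v)
avoids₁⁺ {x} {u} {v} n above ok (a112 ∷ a2122 ∷ []) =
    avoids-remove⁺ p112 binary-112 least removed a112 none112
  ∷ avoids-remove⁺ p2122 binary-2122 least removed a2122 none2122
  ∷ []
  where
  x#u : x # u
  x#u = above-# (All.++⁻ˡ u above)
  x#v : x # v
  x#v = above-# (All.++⁻ʳ u above)
  removed : remove x (u ++ x ∷ body₁ x n v) ≡ u ++ v
  removed = trans (remove-first u _ x#u) (cong (u ++_) (remove-body₁ n x#v))
  least : All (x ≤_) (u ++ x ∷ body₁ x n v)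
  least = All-remove⁻ _ ≤-refl (subst (All (x ≤_)) (sym removed) (All.map <⇒≤ above))
  -- An x other than the first lies in the final block, where nothing larger can follow it.
  after-v : ∀ {q σ} → x < q → q ∈ σ → ¬ x ∷ σ ⊆ body₁ x n v
  after-v x<q q∈σ s =
    <⇒≢ x<q (All.lookup (All-resp-⊆ (skip-# v x#v s) (All.replicate⁺ {P = x ≡_} n refl)) (there q∈σ))
  none112 : ∀ {q} → x < q → ¬ x ∷ x ∷ q ∷ [] ⊆ u ++ x ∷ body₁ x n v
  none112 x<q s = after-v x<q (here refl) (∷⁻ (skip-# u x#u s))
  none2122 : ∀ {q} → x < q → ¬ q ∷ x ∷ q ∷ q ∷ [] ⊆ u ++ x ∷ body₁ x n v
  none2122 {q} x<q s with first-letter u s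
  -- If the first q lies in u, the last two lie in v, against the cut being allowed. Otherwise the x
  -- between the copies of q belongs to the final block.
  ... | inj₁ q∈u = <⇒≱ (replicate⊆⇒≤occ 2 q v
          (subst (_ ⊆_) (remove-body₁ n x#v) (⊆-remove (<⇒≢ x<q ∷ <⇒≢ x<q ∷ [])
            (∷⁻ (skip-# u x#u (∷ˡ⁻ s))))))
          (All.lookup ok q∈u)
  ... | inj₂ s′  = after-v x<q (here refl) (∷ˡ⁻ (∷ʳ⁻ (<⇒≢ x<q ∘ sym) s′))

insertion₁ : Insertion P₁
insertion₁ = record
  { Allowed     = Allowed₁
  ; allowed?    = allowed₁?
  ; body        = body₁
  ; allowed-[]  = []
  ; avoids-[]   = avoids-[] p112 binary-112 ∷ avoids-[] p2122 binary-2122 ∷ []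
  ; remove-body = remove-body₁
  ; occ-body    = occ-body₁
  ; avoids⁻     = avoids₁⁻
  ; avoids⁺     = avoids₁⁺
  ; siteCounts  = siteCounts₁
  }

-- 121 and 1222

-- Three copies of y in v would give x y y y, a 1222, once x stands at the cut.
Allowed₂ : Word → Word → Set
Allowed₂ u v = All (AtMost 2 v) v

allowed₂? : ∀ u v → Dec (Allowed₂ u v)
allowed₂? u v = All.all? (λ y → occurrences y v ≤? 2) v

body₂ : ℕ → ℕ → Word → Word
body₂ x n v = replicate n x ++ v

remove-body₂ : ∀ {x v} n → x # v → remove x (body₂ x n v) ≡ v
remove-body₂ {x} {v} n x#v =
  trans (remove-++ x (replicate n x) v) (cong₂ _++_ (remove-replicate x n) (remove-# x#v))

occ-body₂ : ∀ {x v} n → x # v → occurrences x (body₂ x n v) ≡ n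
occ-body₂ {x} {v} n x#v = trans (occ-++ x (replicate n x) v)
  (trans (cong₂ _+_ (occ-replicate x n) (occ-# x#v)) (+-identityʳ n))

count₂ : Word → Word → ℕ
count₂ = splitCount allowed₂?

allowed₂-remove : ∀ x u t → occurrences x t ≤ 2 → Allowed₂ u t ⇔ Allowed₂ u (remove x t)
allowed₂-remove x u t ≤2 = mk⇔
  (λ ok → Equivalence.to (All-AtMost-remove t (#-remove x t)) (All-remove⁺ x t ok))
  (λ ok → All-remove⁻ t ≤2 (Equivalence.from (All-AtMost-remove t (#-remove x t)) ok))

allowed₂-tail : ∀ {u y v} → Allowed₂ u (y ∷ v) → Allowed₂ u v
allowed₂-tail {u} {y} {v} (_ ∷ ok) =
  All.map (λ {z} → ≤-trans (≤-trans (m≤n+m _ _) (≤-reflexive (sym (occ-++ z (y ∷ []) v))))) ok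

-- The condition is inherited by suffixes, so all cuts from an allowed one on are allowed.
count₂-allowed : ∀ u v → Allowed₂ u v → count₂ u v ≡ suc (length v)
count₂-allowed u []      ok = refl
count₂-allowed u (y ∷ v) ok = trans (splitCount-accept allowed₂? ok)
  (cong suc (count₂-allowed (u ++ y ∷ []) v (allowed₂-tail {u} ok)))

-- With at most two copies of x in all, x forbids no cut. Before the insertion point the cuts
-- correspond one to one; from there on all are allowed, and n + 1 letters have been added.
count₂-prefix-short : ∀ {x n} u₀ u v → n ≤ 1 → x # u ++ v → Allowed₂ u₀ v →
  count₂ u₀ (u ++ x ∷ body₂ x n v) ≡ suc n + count₂ u₀ (u ++ v)
count₂-prefix-short {x} {n} u₀ [] v n≤1 x#v ok = begin
  count₂ u₀ (x ∷ body₂ x n v)           ≡⟨ count₂-allowed u₀ _ ok′ ⟩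
  2 + length (body₂ x n v)              ≡⟨ cong (2 +_) (length-++ (replicate n x)) ⟩
  2 + (length (replicate n x) + length v) ≡⟨ cong (λ k → 2 + (k + length v)) (length-replicate n) ⟩
  2 + (n + length v)                    ≡⟨ cong suc (+-suc n (length v)) ⟨
  suc n + suc (length v)                ≡⟨ cong (suc n +_) (count₂-allowed u₀ v ok) ⟨
  suc n + count₂ u₀ v                   ∎
  where
  open ≡-Reasoning
  ok′ : Allowed₂ u₀ (x ∷ body₂ x n v)
  ok′ = Equivalence.from
    (allowed₂-remove x u₀ (x ∷ body₂ x n v)
      (subst (_≤ 2) (sym (trans (occ-∷≡ x (body₂ x n v)) (cong suc (occ-body₂ n x#v)))) (s≤s n≤1)))
    (subst (Allowed₂ u₀) (sym (trans (remove-∷≡ x (body₂ x n v)) (remove-body₂ n x#v))) ok)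
count₂-prefix-short {x} {n} u₀ (y ∷ u) v n≤1 (x≢y ∷ x#) ok =
  splitCount-∷ allowed₂? 0 (suc n)
    (subst (λ s → Allowed₂ u₀ (y ∷ u ++ x ∷ body₂ x n v) ⇔ Allowed₂ u₀ s) removed
      (allowed₂-remove x u₀ (y ∷ u ++ x ∷ body₂ x n v) few))
    (count₂-prefix-short (u₀ ++ y ∷ []) u v n≤1 x# ok)
  where
  x#u : x # u
  x#u = All.++⁻ˡ u x#
  x#v : x # v
  x#v = All.++⁻ʳ u x#
  removed : remove x (y ∷ u ++ x ∷ body₂ x n v) ≡ y ∷ u ++ v
  removed = trans (remove-first (y ∷ u) _ (x≢y ∷ x#u)) (cong (λ s → y ∷ u ++ s) (remove-body₂ n x#v))
  few : occurrences x (y ∷ u ++ x ∷ body₂ x n v) ≤ 2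
  few = subst (_≤ 2) (sym (trans (occ-++ x (y ∷ u) _) (cong₂ _+_ (occ-# (x≢y ∷ x#u))
    (trans (occ-∷≡ x _) (cong suc (occ-body₂ n x#v)))))) (s≤s n≤1)

-- Every suffix that keeps three copies of x is forbidden.
count₂-prefix-long : ∀ {x} u₀ u t → 3 ≤ occurrences x t → ∃[ u₁ ] count₂ u₀ (u ++ t) ≡ count₂ u₁ t
count₂-prefix-long {x} u₀ []      t many = u₀ , refl
count₂-prefix-long {x} u₀ (y ∷ u) t many =
  let u₁ , eq = count₂-prefix-long (u₀ ++ y ∷ []) u t many
  in u₁ , trans (splitCount-reject allowed₂? λ ok →
       <⇒≱ many′ (All.lookup ok x∈)) eq
  where
  many′ : 3 ≤ occurrences x (y ∷ u ++ t)
  many′ = ≤-trans many (≤-trans (m≤n+m _ _) (≤-reflexive (sym (occ-++ x (y ∷ u) t))))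
  x∈ : x ∈ y ∷ u ++ t
  x∈ = to∈ (≤occ⇒replicate⊆ 1 x _ (≤-trans (s≤s z≤n) many′))

replicate-shift : ∀ (x : ℕ) k s → x ∷ replicate k x ++ s ≡ replicate k x ++ x ∷ s
replicate-shift x zero    s = refl
replicate-shift x (suc k) s = cong (x ∷_) (replicate-shift x k s)

-- A cut may leave at most two copies of x on the right. The surviving cuts are those of v and the
-- two before the last two copies.
siteCount₂-long : ∀ {x} k u v → x # u ++ v → Allowed₂ u v →
  count₂ [] (u ++ x ∷ body₂ x (2 + k) v) ≡ 2 + count₂ u v
siteCount₂-long {x} k u v x# ok = begin
  count₂ [] (u ++ x ∷ body₂ x (2 + k) v)           ≡⟨ cong (count₂ []) regroup ⟩
  -- Exactly three copies are kept in front of v: the cut before them is the last forbidden one.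
  count₂ [] ((u ++ replicate k x) ++ x ∷ x ∷ x ∷ v) ≡⟨ proj₂ (count₂-prefix-long {x} [] (u ++ replicate k x) _ many) ⟩
  count₂ u₁ (x ∷ x ∷ x ∷ v)                        ≡⟨ splitCount-reject allowed₂? {u₁} {x} {x ∷ x ∷ v}
    (λ { (few ∷ _) → <⇒≱ many few }) ⟩
  count₂ (u₁ ++ x ∷ []) (x ∷ x ∷ v)                ≡⟨ count₂-allowed (u₁ ++ x ∷ []) (x ∷ x ∷ v) ok′ ⟩
  3 + length v                                     ≡⟨ cong (2 +_) (count₂-allowed u v ok) ⟨
  2 + count₂ u v                                   ∎
  where
  open ≡-Reasoning
  x#v : x # v
  x#v = All.++⁻ʳ u x#
  many : 3 ≤ occurrences x (x ∷ x ∷ x ∷ v)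
  many = replicate⊆⇒≤occ 3 x _ (refl ∷ refl ∷ refl ∷ minimum v)
  u₁ = proj₁ (count₂-prefix-long {x} [] (u ++ replicate k x) _ many)
  regroup : u ++ x ∷ body₂ x (2 + k) v ≡ (u ++ replicate k x) ++ x ∷ x ∷ x ∷ v
  regroup = trans (cong (u ++_)
      (trans (cong (λ s → x ∷ x ∷ s) (replicate-shift x k v))
        (trans (cong (x ∷_) (replicate-shift x k (x ∷ v))) (replicate-shift x k (x ∷ x ∷ v)))))
    (sym (++-assoc u (replicate k x) _))
  ok′ : Allowed₂ u₁ (x ∷ x ∷ v)
  ok′ = Equivalence.from (allowed₂-remove x u₁ (x ∷ x ∷ v) (≤-reflexive (occ-body₂ 2 x#v)))
    (subst (Allowed₂ u₁) (sym (remove-body₂ 2 x#v)) ok)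

siteCounts₂ : ∀ {x w} n → x # w →
  map (count₂ []) (map (λ s → proj₁ s ++ x ∷ body₂ x n (proj₂ s)) (allowedSplits allowed₂? [] w)) ↭
  nexts n (count₂ [] w)
siteCounts₂ {x} {w} n x#w = ↭-trans (↭-reflexive (sym (map-∘ L))) (counts n)
  where
  open ≡-Reasoning
  L = allowedSplits allowed₂? [] w
  m = count₂ [] w
  short : ∀ {n} → n ≤ 1 →
    map (λ s → count₂ [] (proj₁ s ++ x ∷ body₂ x n (proj₂ s))) L ≡ replicate m (suc n + m)
  short n≤1 = map-const-local _ _ (All.map
    (λ { {u , v} (refl , ok) → count₂-prefix-short [] u v n≤1 x#w ok }) (allowedSplits-sound allowed₂? w))
  counts : ∀ n → map (λ s → count₂ [] (proj₁ s ++ x ∷ body₂ x n (proj₂ s))) L ↭ nexts n m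
  counts 0             = ↭-reflexive (short z≤n)
  counts 1             = ↭-reflexive (short ≤-refl)
  counts (suc (suc k)) = ↭-trans (↭-reflexive (begin
    map (λ s → count₂ [] (proj₁ s ++ x ∷ body₂ x (2 + k) (proj₂ s))) L
      ≡⟨ map-cong-local (All.map (λ { {u , v} (refl , ok) → siteCount₂-long k u v x#w ok })
           (allowedSplits-sound allowed₂? w)) ⟩
    map (λ s → 2 + uncurry count₂ s) L            ≡⟨ map-∘ L ⟩
    map (2 +_) (map (uncurry count₂) L)           ≡⟨ cong (map _) (counts-descend allowed₂? [] w) ⟩
    map (2 +_) (map suc (downFrom m))             ≡⟨ map-∘ (downFrom m) ⟨
    -- The labels fall from m + 2 to 3, the reverse of the order in `nexts`.
    map (3 +_) (downFrom m)                       ≡⟨ cong (map (3 +_)) (reverse-upTo m) ⟨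
    map (3 +_) (reverse (upTo m))                 ∎))
    (↭.map⁺ (3 +_) (↭.↭-reverse (upTo m)))

P₂ : PatternSet
P₂ = p121 ∷ p1222 ∷ []

avoids₂⁻ : ∀ {x n w} → All (x ≤_) w → occurrences x w ≡ suc n → AvoidsAll P₂ w →
  ∃[ u ] ∃[ v ] u ++ v ≡ remove x w × w ≡ u ++ x ∷ body₂ x n v × Allowed₂ u v × AvoidsAll P₂ (u ++ v)
avoids₂⁻ {x} {n} {w} least occ (a121 ∷ a1222 ∷ [])
  with r121 , none121 ← avoids-remove⁻ p121 x w binary-121 a121
  with r1222 , none1222 ← avoids-remove⁻ p1222 x w binary-1222 a1222
  with u , t , refl , x#u , refl ← split-first w occ =
  let removed = remove-first u t x#u
      least-t = All.tail (All.++⁻ʳ u least) in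
    u , remove x t , sym removed
  , cong (λ s → u ++ x ∷ s) (sorted-ascending t least-t
      λ x<q s → none121 x<q (++⁺ˡ u (refl ∷ s)))
  -- Three copies of y after the first x would complete x y y y.
  , All.zipWith (λ {y} (x≤y , x≢y) → ≮⇒≥ λ 2<occ →
      none1222 (≤∧≢⇒< x≤y x≢y)
        (++⁺ˡ u (refl ∷ ⊆-trans (≤occ⇒replicate⊆ 3 y _ 2<occ) (filter-⊆ (≢? x) t))))
      (All-remove⁺ x t least-t , #-remove x t)
  , subst (AvoidsAll P₂) removed (r121 ∷ r1222 ∷ [])

avoids₂⁺ : ∀ {x u v} n → All (x <_) (u ++ v) → Allowed₂ u v → AvoidsAll P₂ (u ++ v) →
  AvoidsAll P₂ (u ++ x ∷ body₂ x n v)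
avoids₂⁺ {x} {u} {v} n above ok (a121 ∷ a1222 ∷ []) =
    avoids-remove⁺ p121 binary-121 least removed a121 none121
  ∷ avoids-remove⁺ p1222 binary-1222 least removed a1222 none1222
  ∷ []
  where
  x#u : x # u
  x#u = above-# (All.++⁻ˡ u above)
  x#v : x # v
  x#v = above-# (All.++⁻ʳ u above)
  removed : remove x (u ++ x ∷ body₂ x n v) ≡ u ++ v
  removed = trans (remove-first u _ x#u) (cong (u ++_) (remove-body₂ n x#v))
  least : All (x ≤_) (u ++ x ∷ body₂ x n v)
  least = All-remove⁻ _ ≤-refl (subst (All (x ≤_)) (sym removed) (All.map <⇒≤ above))
  -- The copies of x form a single block, so a larger letter after any of them lies in v.
  in-v : ∀ {q σ} → x < q → x ∷ q ∷ σ ⊆ u ++ x ∷ body₂ x n v → q ∷ σ ⊆ v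
  in-v x<q s = skip-# (replicate n x) (#-replicate n (<⇒≢ x<q ∘ sym)) (∷⁻ (skip-# u x#u s))
  none121 : ∀ {q} → x < q → ¬ x ∷ q ∷ x ∷ [] ⊆ u ++ x ∷ body₂ x n v
  none121 x<q s = All.lookup (All-resp-⊆ (in-v x<q s) x#v) (there (here refl)) refl
  none1222 : ∀ {q} → x < q → ¬ x ∷ q ∷ q ∷ q ∷ [] ⊆ u ++ x ∷ body₂ x n v
  none1222 {q} x<q s =
    <⇒≱ (replicate⊆⇒≤occ 3 q v (in-v x<q s)) (All.head (All-resp-⊆ (in-v x<q s) ok))

insertion₂ : Insertion P₂
insertion₂ = record
  { Allowed     = Allowed₂
  ; allowed?    = allowed₂?
  ; body        = body₂
  ; allowed-[]  = []
  ; avoids-[]   = avoids-[] p121 binary-121 ∷ avoids-[] p1222 binary-1222 ∷ []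
  ; remove-body = remove-body₂
  ; occ-body    = occ-body₂
  ; avoids⁻     = avoids₂⁻
  ; avoids⁺     = avoids₂⁺
  ; siteCounts  = siteCounts₂
  }

theorem2p12 : ((1 ∷ 1 ∷ 2 ∷ []) ∷ (2 ∷ 1 ∷ 2 ∷ 2 ∷ []) ∷ [])
    ~ ((1 ∷ 2 ∷ 1 ∷ []) ∷ (1 ∷ 2 ∷ 2 ∷ 2 ∷ []) ∷ [])
theorem2p12 = insertion⇒~ insertion₁ insertion₂
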